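{- Let $n,m\ge 2$ be integers, let $G=K_n\,\square\,K_m$, and let $k$ be an integer with $1\le k\le\kappa(G)$. Consider the integer linear program $F_{gh}$ in the variables $s_u$ ($u\in V(G)$), $h_j$ ($j\in\mathbb{Z}_m$), $g_i$ ($i\in\mathbb{Z}_n$): $$\begin{aligned} \min\ & \sum_{u\in V(G)}s_u\\ \text{s.t. } & h_j=\sum_{u\in V(K_n^j)}s_u && j\in\mathbb{Z}_m && (1)\\ & g_i=\sum_{u\in V({}^iK_m)}s_u && i\in\mathbb{Z}_n && (2)\\ & h_j+h_{j'}\ge k && j,j'\in\mathbb{Z}_m,\ j\neq j' && (3)\\ & g_i+g_{i'}\ge k && i,i'\in\mathbb{Z}_n,\ i\neq i' && (4)\\ & h_{j_u}+h_{j_v}+g_{i_u}+g_{i_v}-2s_{\tilde u}-2s_{\tilde v}\ge k && u,v\in V(G)\text{ distinct, not aligned} && (5)\\ & s_u\in\{0,1\} && u\in V(G)\\ & h_j,\,g_i\in\mathbb{Z} && j\in\mathbb{Z}_m,\ i\in\mathbb{Z}_n, \end{aligned}$$ where $u=(i_u,j_u)$, $v=(i_v,j_v)$, $\tilde u=(i_u,j_v)$, $\tilde v=(i_v,j_u)$, and in (3), (4), (5) there is one constraint for each unordered pair. Then: (a) $F_{gh}$ produces a weak $k$-metric basis of $G$: it has an optimal solution, and for every optimal solution the set $S=\{u\in V(G): s_u=1\}$ is a weak $k$-metric basis of $G$. (b) $F_{gh}$ has $m$ constraints (1) and $n$ constraints (2); the numbers of constraints (3) and (4) are $O(m^2)$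 and $O(n^2)$, respectively; and the number of constraints (5) is $O(n^2m^2)$. The constraints (5) are only needed when $k\le 3$, i.e. for $k\ge 4$ they may be omitted without changing the set of feasible solutions. (c) For $k\ge 4$, the constraints of $F_{gh}$ on $S=\{u: s_u=1\}$ amount to the following: every pair of distinct vertical layers must contain (in total) at least $k$ elements of $S$, and every pair of distinct horizontal layers must contain (in total) at least $k$ elements of $S$.
   Context: $K_n\,\square\,K_m$ is the Cartesian product of complete graphs, with vertex set $\mathbb{Z}_n\times\mathbb{Z}_m$; two distinct vertices are adjacent iff they agree in exactly one coordinate. For $i\in\mathbb{Z}_n$, the vertical layer ${}^iK_m$ is the subgraph induced by $\{i\}\times\mathbb{Z}_m$; for $j\in\mathbb{Z}_m$, the horizontal layer $K_n^j$ is the subgraph induced by $\mathbb{Z}_n\times\{j\}$. Two vertices are called aligned if they agree in exactly one coordinate. For a connected finite simple graph $G$, $d_G(a,b)$ is the number of edges on a shortest $a,b$-path, and $\Delta_z(x,y)=|d_G(x,z)-d_G(y,z)|$. For an integer $k\ge 1$, a set $S\subseteq V(G)$ is a weak $k$-resolving set of $G$ if $\sum_{w\in S}\Delta_w(x,y)\ge k$ for every two distinct vertices $x,y\in V(G)$; a weak $k$-metric basis of $G$ is a weak $k$-resolving set of minimum cardinality. $\kappa(G)$ is the largest integer $k$ such that $G$ has a weak $k$-resolving set. -}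

module Defs where

open import Level using (0ℓ)
open import Data.Bool using (Bool; _∧_)
open import Data.Nat as ℕ using (ℕ; zero; suc; z≤n; s≤s; ∣_-_∣)
open import Data.Integer as ℤ using (ℤ; +_; -_; 0ℤ; 1ℤ)
open import Data.Fin as Fin using (Fin)
open import Data.Fin.Properties as Fin using ()
open import Data.List using (List; []; _∷_; _++_; map; length; foldr; filter; filterᵇ; allFin; cartesianProduct)
open import Data.Nat.ListAction using (sum)
open import Data.List.Membership.Propositional using (_∈_; _∉_)
open import Data.List.Membership.DecPropositional as DecMembership using ()
open import Data.List.Membership.Propositional.Properties using (∈-cartesianProduct⁺; ∈-allFin)
open import Data.List.Relation.Unary.All using (All)
open import Data.List.Relation.Unary.Any as Any using (Any; here; there)
open import Data.List.Relation.Unary.Unique.Propositional using (Unique)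
open import Data.List.Relation.Unary.Unique.Propositional.Properties using (cartesianProduct⁺; allFin⁺)
open import Data.Product using (_×_; _,_; ∃; ∃-syntax; proj₁; proj₂)
open import Data.Product.Properties using (≡-dec)
open import Data.Sum using (_⊎_; inj₁; inj₂)
open import Data.Unit using (⊤)
open import Function using (_∘_)
open import Relation.Binary using (Rel; DecidableEquality; Symmetric; Decidable)
open import Relation.Binary.PropositionalEquality using (_≡_; _≢_; refl; sym; ≢-sym)
open import Relation.Nullary using (¬_; Dec; yes; no; does; contradiction; ¬?; _×-dec_; _⊎-dec_)
open import Relation.Nullary.Decidable using (map′)
open import Relation.Unary as Unary using ()

record Graph : Set₁ where
  infix 4 _≟_ _~_ _~?_
  field
    V        : Set
    _≟_      : DecidableEquality V
    vertices : List V
    complete : ∀ v → v ∈ vertices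
    unique   : Unique vertices
    _~_      : Rel V 0ℓ
    _~?_     : Decidable _~_
    ~-sym    : Symmetric _~_
    ~-irrefl : ∀ v → ¬ v ~ v

  open DecMembership _≟_ using (_∈?_)

  -- PathAvoiding xs a b ℓ: paths from a to b with ℓ edges that repeat no
  -- vertex and visit no vertex of xs.
  data PathAvoiding (xs : List V) : V → V → ℕ → Set where
    stop : ∀ {a} → a ∉ xs → PathAvoiding xs a a 0
    step : ∀ {a b c ℓ} → a ∉ xs → a ~ c →
           PathAvoiding (a ∷ xs) c b ℓ → PathAvoiding xs a b (suc ℓ)

  Path : V → V → ℕ → Set
  Path = PathAvoiding []

  private
    pathAvoiding? : ∀ xs a b ℓ → Dec (PathAvoiding xs a b ℓ)
    pathAvoiding? xs a b zero with a ≟ b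
    ... | no a≢b   = no λ { (stop _) → a≢b refl }
    ... | yes refl = map′ stop (λ { (stop a∉xs) → a∉xs }) (¬? (a ∈? xs))
    pathAvoiding? xs a b (suc ℓ) = map′ to from
      (¬? (a ∈? xs) ×-dec Any.any? (λ c → (a ~? c) ×-dec pathAvoiding? (a ∷ xs) c b ℓ) vertices)
      where
      Step : V → Set
      Step c = a ~ c × PathAvoiding (a ∷ xs) c b ℓ

      to : a ∉ xs × Any Step vertices → PathAvoiding xs a b (suc ℓ)
      to (a∉xs , any) = let (_ , a~c , p) = Any.satisfied any in step a∉xs a~c p

      from : PathAvoiding xs a b (suc ℓ) → a ∉ xs × Any Step vertices
      from (step {c = c} a∉xs a~c p) =
        a∉xs , Any.map (λ { refl → a~c , p }) (complete c)

  path? : ∀ a b → Unary.Decidable (Path a b)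
  path? a b = pathAvoiding? [] a b

least : ∀ {P : ℕ → Set} → Unary.Decidable P → ∀ n → P n →
        ∃[ ℓ ] P ℓ × (∀ {j} → P j → ℓ ℕ.≤ j)
least P? n p with P? 0
least P? n p       | yes p₀ = 0 , p₀ , λ _ → z≤n
least P? zero p    | no ¬p₀ = contradiction p ¬p₀
least P? (suc n) p | no ¬p₀ =
  let (ℓ , pℓ , ℓ≤) = least (P? ∘ suc) n p
  in suc ℓ , pℓ , λ { {zero} q → contradiction q ¬p₀ ; {suc j} q → s≤s (ℓ≤ q) }

record ConnectedGraph : Set₁ where
  field
    graph     : Graph
  open Graph graph public
  field
    connected : ∀ a b → ∃[ ℓ ] Path a b ℓ

  private
    shortest : ∀ a b → ∃[ ℓ ] Path a b ℓ × (∀ {j} → Path a b j → ℓ ℕ.≤ j)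
    shortest a b = least (path? a b) (proj₁ (connected a b)) (proj₂ (connected a b))

  d : V → V → ℕ
  d a b = proj₁ (shortest a b)

  d-path : ∀ a b → Path a b (d a b)
  d-path a b = proj₁ (proj₂ (shortest a b))

  d-minimal : ∀ a b {ℓ} → Path a b ℓ → d a b ℕ.≤ ℓ
  d-minimal a b = proj₂ (proj₂ (shortest a b))

  Δ : V → V → V → ℕ
  Δ z x y = ∣ d x z - d y z ∣

  VertexSet : Set
  VertexSet = V → Bool

  elements : VertexSet → List V
  elements S = filterᵇ S vertices

  card : VertexSet → ℕ
  card S = length (elements S)

  _∩_ : VertexSet → VertexSet → VertexSet
  (S ∩ L) v = S v ∧ L v

  WeakResolving : ℕ → VertexSet → Set
  WeakResolving k S = ∀ x y → x ≢ y → k ℕ.≤ sum (map (λ w → Δ w x y) (elements S))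

  WeakBasis : ℕ → VertexSet → Set
  WeakBasis k S = WeakResolving k S × (∀ T → WeakResolving k T → card S ℕ.≤ card T)

  -- κ(G), as a predicate: a graph with a single vertex has no such largest k.
  IsKappa : ℕ → Set
  IsKappa κ = (∃[ S ] WeakResolving κ S)
            × (∀ k → (∃[ S ] WeakResolving k S) → k ℕ.≤ κ)

LinExpr : Set → Set
LinExpr X = List (ℤ × X)

infix 4 _≐_ _≽_

data Constraint (X : Set) : Set where
  _≐_ : LinExpr X → LinExpr X → Constraint X
  _≽_ : LinExpr X → ℤ → Constraint X

data Domain : Set where
  binary integer : Domain

record ILP (X : Set) : Set where
  field
    objective   : LinExpr X
    constraints : List (Constraint X)
    domain      : X → Domain

module _ {X : Set} where

  ⟦_⟧ : LinExpr X → (X → ℤ) → ℤ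
  ⟦ e ⟧ σ = foldr (λ (c , x) r → c ℤ.* σ x ℤ.+ r) 0ℤ e

  Satisfies : (X → ℤ) → Constraint X → Set
  Satisfies σ (e ≐ f) = ⟦ e ⟧ σ ≡ ⟦ f ⟧ σ
  Satisfies σ (e ≽ c) = c ℤ.≤ ⟦ e ⟧ σ

  InDomain : Domain → ℤ → Set
  InDomain binary  z = z ≡ 0ℤ ⊎ z ≡ 1ℤ
  InDomain integer z = ⊤

  Feasible : ILP X → (X → ℤ) → Set
  Feasible F σ = All (Satisfies σ) (ILP.constraints F)
               × (∀ x → InDomain (ILP.domain F x) (σ x))

  Optimal : ILP X → (X → ℤ) → Set
  Optimal F σ = Feasible F σ
              × (∀ τ → Feasible F τ → ⟦ ILP.objective F ⟧ σ ℤ.≤ ⟦ ILP.objective F ⟧ τ)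

-- The unordered pairs of entries at distinct positions, each listed once.
pairs : ∀ {A : Set} → List A → List (A × A)
pairs []       = []
pairs (x ∷ xs) = map (x ,_) xs ++ pairs xs

module Rook (n m : ℕ) where

  Vertex : Set
  Vertex = Fin n × Fin m

  Aligned : Rel Vertex 0ℓ
  Aligned (i , j) (i′ , j′) = (i ≡ i′ × j ≢ j′) ⊎ (i ≢ i′ × j ≡ j′)

  aligned? : Decidable Aligned
  aligned? (i , j) (i′ , j′) =
    ((i Fin.≟ i′) ×-dec ¬? (j Fin.≟ j′)) ⊎-dec (¬? (i Fin.≟ i′) ×-dec (j Fin.≟ j′))

  rookGraph : Graph
  rookGraph = record
    { V        = Vertex
    ; _≟_      = ≡-dec Fin._≟_ Fin._≟_
    ; vertices = cartesianProduct (allFin n) (allFin m)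
    ; complete = λ (i , j) → ∈-cartesianProduct⁺ (∈-allFin i) (∈-allFin j)
    ; unique   = cartesianProduct⁺ (allFin⁺ n) (allFin⁺ m)
    ; _~_      = Aligned
    ; _~?_     = aligned?
    ; ~-sym    = λ { (inj₁ (p , q)) → inj₁ (sym p , ≢-sym q)
                   ; (inj₂ (p , q)) → inj₂ (≢-sym p , sym q) }
    ; ~-irrefl = λ { _ (inj₁ (_ , q)) → q refl ; _ (inj₂ (p , _)) → p refl }
    }

  private
    open Graph rookGraph using (Path; stop; step)

    rook-connected : ∀ a b → ∃[ ℓ ] Path a b ℓ
    rook-connected (i , j) (i′ , j′) with i Fin.≟ i′ | j Fin.≟ j′
    ... | yes refl | yes refl = 0 , stop λ ()
    ... | yes refl | no j≢j′  = 1 ,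
      step (λ ()) (inj₁ (refl , j≢j′)) (stop λ { (here refl) → j≢j′ refl })
    ... | no i≢i′  | yes refl = 1 ,
      step (λ ()) (inj₂ (i≢i′ , refl)) (stop λ { (here refl) → i≢i′ refl })
    ... | no i≢i′  | no j≢j′  = 2 ,
      step (λ ()) (inj₂ (i≢i′ , refl))
        (step (λ { (here refl) → i≢i′ refl }) (inj₁ (refl , j≢j′))
          (stop λ { (here refl) → j≢j′ refl ; (there (here refl)) → i≢i′ refl }))

  K□K : ConnectedGraph
  K□K = record { graph = rookGraph ; connected = rook-connected }

  open ConnectedGraph K□K public
    using (vertices; VertexSet; elements; card; _∩_; WeakResolving; WeakBasis; IsKappa)

  -- Vertex sets of the layers ⁱKₘ and Kₙʲ.
  vertical : Fin n → VertexSet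
  vertical i (i′ , _) = does (i′ Fin.≟ i)

  horizontal : Fin m → VertexSet
  horizontal j (_ , j′) = does (j′ Fin.≟ j)

  -- The integer program F_gh. Its list of constraints is kept syntactic so
  -- that constraints can be counted.
  data Var : Set where
    s : Vertex → Var
    h : Fin m → Var
    g : Fin n → Var

  domain : Var → Domain
  domain (s _) = binary
  domain (h _) = integer
  domain (g _) = integer

  sumS : List Vertex → LinExpr Var
  sumS = map (λ u → 1ℤ , s u)

  hDefs : List (Constraint Var)
  hDefs = map (λ j → ((1ℤ , h j) ∷ []) ≐ sumS (elements (horizontal j))) (allFin m)

  gDefs : List (Constraint Var)
  gDefs = map (λ i → ((1ℤ , g i) ∷ []) ≐ sumS (elements (vertical i))) (allFin n)

  hPairs : ℕ → List (Constraint Var)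
  hPairs k = map (λ (j , j′) → ((1ℤ , h j) ∷ (1ℤ , h j′) ∷ []) ≽ + k) (pairs (allFin m))

  gPairs : ℕ → List (Constraint Var)
  gPairs k = map (λ (i , i′) → ((1ℤ , g i) ∷ (1ℤ , g i′) ∷ []) ≽ + k) (pairs (allFin n))

  nonAligned : ℕ → Vertex × Vertex → Constraint Var
  nonAligned k ((iᵤ , jᵤ) , (iᵥ , jᵥ)) =
    ( (1ℤ , h jᵤ) ∷ (1ℤ , h jᵥ) ∷ (1ℤ , g iᵤ) ∷ (1ℤ , g iᵥ)
    ∷ (- (+ 2) , s (iᵤ , jᵥ)) ∷ (- (+ 2) , s (iᵥ , jᵤ)) ∷ []) ≽ + k

  nonAlignedPairs : ℕ → List (Constraint Var)
  nonAlignedPairs k =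
    map (nonAligned k) (filter (λ (u , v) → ¬? (aligned? u v)) (pairs vertices))

  F-without-nonAligned : ℕ → ILP Var
  F-without-nonAligned k = record
    { objective   = sumS vertices
    ; constraints = hDefs ++ gDefs ++ hPairs k ++ gPairs k
    ; domain      = domain
    }

  F : ℕ → ILP Var
  F k = record
    { objective   = sumS vertices
    ; constraints = hDefs ++ gDefs ++ hPairs k ++ gPairs k ++ nonAlignedPairs k
    ; domain      = domain
    }

  support : (Var → ℤ) → VertexSet
  support σ u = does (σ (s u) ℤ.≟ 1ℤ)

  LayerPairsContain : ℕ → VertexSet → Set
  LayerPairsContain k S =
      (∀ i i′ → i ≢ i′ → k ℕ.≤ card (S ∩ vertical i) ℕ.+ card (S ∩ vertical i′))
    × (∀ j j′ → j ≢ j′ → k ℕ.≤ card (S ∩ horizontal j) ℕ.+ card (S ∩ horizontal j′))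

Admissible : ℕ → ℕ → ℕ → Set
Admissible n m k =
  2 ℕ.≤ n × 2 ℕ.≤ m × 1 ℕ.≤ k × (∃[ κ ] Rook.IsKappa n m κ × k ℕ.≤ κ)

-- f n m k = O(b n m k), with one constant for all admissible n, m, k.
BigO : (f b : ℕ → ℕ → ℕ → ℕ) → Set
BigO f b = ∃[ C ] (∀ n m k → Admissible n m k → f n m k ℕ.≤ C ℕ.* b n m k)

-- In K□K the distance is the Hamming distance, so Δ_w(x , y) can be read off from the layers
-- through x and y that contain w.  Summed over S, it gives the two layer counts of (3) or (4)
-- when x and y are aligned, and the left-hand side of (5) when they agree in no coordinate.
-- Hence the feasible points of F k are exactly the encodings of weak k-resolving sets, and the
-- objective is the cardinality.

module Submission where

open import Defs
open import Data.Bool using (Bool; true; false; not; _∧_; T)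
open import Data.Bool.Properties using (T?)
open import Data.Fin as Fin using (Fin; combine; remQuot; fromℕ<)
open import Data.Fin.Properties using (all?; remQuot-combine)
open import Data.Fin.Subset using (Subset)
open import Data.Fin.Subset.Properties using (anySubset?)
open import Data.Integer as ℤ using (ℤ; +_; -_; 0ℤ; 1ℤ; +≤+)
import Data.Integer.Properties as ℤ
open import Data.Integer.Tactic.RingSolver using (solve-∀)
open import Data.Nat using (ℕ; suc; _+_; _≤_; _*_; _^_; z≤n; s≤s; ∣_-_∣)
open import Data.Nat.ListAction using (sum)
open import Data.Nat.Properties hiding (_≟_)
import Data.Nat.Properties as ℕ using (_≟_)
import Data.Nat.Tactic.RingSolver as ℕ using (solve-∀)
open import Algebra.Properties.CommutativeSemigroup +-commutativeSemigroup using (interchange)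
open import Data.List using (List; []; _∷_; _++_; map; length; filter; filterᵇ; allFin; cartesianProduct)
open import Data.List.Membership.Propositional using (_∈_; _∉_)
open import Data.List.Membership.Propositional.Properties using (∈-allFin)
open import Data.List.Properties using (length-map; length-++; length-tabulate; length-filter; filter-≐; map-cong)
open import Data.List.Relation.Unary.All as All using (All; []; _∷_)
import Data.List.Relation.Unary.All.Properties as All
open import Data.List.Relation.Unary.AllPairs using ([]; _∷_)
open import Data.List.Relation.Unary.Any using (here; there)
open import Data.List.Relation.Unary.Unique.Propositional using (Unique)
open import Data.List.Relation.Unary.Unique.Propositional.Properties using (allFin⁺)
open import Data.Product using (_×_; _,_; proj₁; proj₂; ∃-syntax; uncurry)
open import Data.Sum using (inj₁; inj₂; [_,_]′)
open import Data.Vec using (lookup; tabulate)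
open import Data.Vec.Properties using (lookup∘tabulate)
open import Data.Unit using (tt)
open import Function using (_∘_)
open import Function.Bundles using (_⇔_; mk⇔; Equivalence)
open import Relation.Binary using (Rel; Symmetric; DecidableEquality)
open import Relation.Binary.PropositionalEquality
open import Relation.Nullary using (¬_; yes; no; does; contradiction; ¬?; _×-dec_; _→-dec_)
open import Relation.Nullary.Decidable using (map′; does-⇔; dec-true; dec-false)
open import Relation.Unary using (Pred; Decidable)
open import Level using (0ℓ)

open Equivalence using (to; from)

-- Indicator sums, filtered lists and lists of pairs

χ : Bool → ℕ
χ false = 0
χ true  = 1

χ≤1 : ∀ b → χ b ≤ 1
χ≤1 false = z≤n
χ≤1 true  = s≤s z≤n

module _ {A : Set} where

  sum-map-+ : ∀ (f g : A → ℕ) xs →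
              sum (map (λ x → f x + g x) xs) ≡ sum (map f xs) + sum (map g xs)
  sum-map-+ f g []       = refl
  sum-map-+ f g (x ∷ xs) = trans (cong (_+_ (f x + g x)) (sum-map-+ f g xs))
    (interchange (f x) (g x) (sum (map f xs)) (sum (map g xs)))

  -- The program sums the `s`-variables over the vertices of one layer, so there the layer filter
  -- comes before the filter for `S`; this matches that order with `card (S ∩ L)`. The opposite
  -- order, used for sums of `Δ` over `S`, is handled by `sum-χ-filterᵇ`.
  length-filterᵇ-∧ : ∀ (p q : A → Bool) xs →
                     length (filterᵇ (λ x → p x ∧ q x) xs) ≡ length (filterᵇ p (filterᵇ q xs))
  length-filterᵇ-∧ p q []       = refl
  length-filterᵇ-∧ p q (x ∷ xs) with q x | p x in eq
  ... | false | false = length-filterᵇ-∧ p q xs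
  ... | false | true  = length-filterᵇ-∧ p q xs
  ... | true  | false rewrite eq = length-filterᵇ-∧ p q xs
  ... | true  | true  rewrite eq = cong suc (length-filterᵇ-∧ p q xs)

  sum-χ-filterᵇ : ∀ (p q : A → Bool) xs →
                  length (filterᵇ (λ x → p x ∧ q x) xs) ≡ sum (map (χ ∘ q) (filterᵇ p xs))
  sum-χ-filterᵇ p q []       = refl
  sum-χ-filterᵇ p q (x ∷ xs) with p x | q x in eq
  ... | false | _     = sum-χ-filterᵇ p q xs
  ... | true  | false rewrite eq = sum-χ-filterᵇ p q xs
  ... | true  | true  rewrite eq = cong suc (sum-χ-filterᵇ p q xs)

  filterᵇ-cong : ∀ {p q : A → Bool} → p ≗ q → filterᵇ p ≗ filterᵇ q
  filterᵇ-cong {p} {q} p≗q = filter-≐ (T? ∘ p) (T? ∘ q)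
    ((λ {x} → subst T (p≗q x)) , (λ {x} → subst T (sym (p≗q x))))

  module _ (_≟_ : DecidableEquality A) (p : A → Bool) (v : A) where

    private
      mass : List A → ℕ
      mass xs = sum (map (λ x → χ (does (x ≟ v))) (filterᵇ p xs))

    sum-filterᵇ-∉ : ∀ {xs} → v ∉ xs → mass xs ≡ 0
    sum-filterᵇ-∉ {[]}     _ = refl
    sum-filterᵇ-∉ {x ∷ xs} v∉ with p x
    ... | false = sum-filterᵇ-∉ (v∉ ∘ there)
    ... | true  = cong₂ _+_ (cong χ (dec-false (x ≟ v) (v∉ ∘ here ∘ sym)))
                            (sum-filterᵇ-∉ (v∉ ∘ there))

    -- In a list without repetitions `v` is met exactly once, and that occurrence survives the
    -- filter iff `p v` holds. This evaluates a sum over `S` that is concentrated at a single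
    -- vertex.
    sum-filterᵇ-∈ : ∀ {xs} → Unique xs → v ∈ xs → mass xs ≡ χ (p v)
    sum-filterᵇ-∈ {x ∷ xs} (x∉ ∷ _) (here refl) with p x
    ... | false = sum-filterᵇ-∉ (λ v∈ → All.lookup x∉ v∈ refl)
    ... | true  = cong₂ _+_ (cong χ (dec-true (x ≟ x) refl))
                            (sum-filterᵇ-∉ (λ v∈ → All.lookup x∉ v∈ refl))
    sum-filterᵇ-∈ {x ∷ xs} (x∉ ∷ xs!) (there v∈) with p x
    ... | false = sum-filterᵇ-∈ xs! v∈
    ... | true  = cong₂ _+_ (cong χ (dec-false (x ≟ v) (All.lookup x∉ v∈)))
                            (sum-filterᵇ-∈ xs! v∈)

  module _ {P Q : Pred A 0ℓ} (P? : Decidable P) where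

    -- Moves the filter condition into an implication, so that constraints on a filtered list of
    -- pairs can be treated by `pairs⁺` and `pairs⁻` on the full list.
    All-filter⁺ : ∀ {xs} → All (λ x → P x → Q x) xs → All Q (filter P? xs)
    All-filter⁺ []             = []
    All-filter⁺ {x ∷ _} (f ∷ fs) with P? x
    ... | no _   = All-filter⁺ fs
    ... | yes px = f px ∷ All-filter⁺ fs

    All-filter⁻ : ∀ {xs} → All Q (filter P? xs) → All (λ x → P x → Q x) xs
    All-filter⁻ {[]}     _  = []
    All-filter⁻ {x ∷ xs} qs with P? x
    All-filter⁻ {x ∷ xs} qs       | no ¬px = (λ px → contradiction px ¬px) ∷ All-filter⁻ qs
    All-filter⁻ {x ∷ xs} (q ∷ qs) | yes _  = (λ _ → q) ∷ All-filter⁻ qs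

  module _ {R : Rel A 0ℓ} where

    -- `pairs` separates positions only; uniqueness turns distinct positions into distinct entries.
    pairs⁺ : ∀ {xs} → Unique xs → (∀ x y → x ≢ y → R x y) → All (uncurry R) (pairs xs)
    pairs⁺ []         _ = []
    pairs⁺ (x∉ ∷ xs!) f = All.++⁺ (All.map⁺ (All.map (f _ _) x∉)) (pairs⁺ xs! f)

    -- Each unordered pair is listed in one order only, the earlier entry first, and symmetry of `R`
    -- supplies the other order.
    pairs⁻ : Symmetric R → ∀ {xs} → All (uncurry R) (pairs xs) →
             ∀ {x y} → x ∈ xs → y ∈ xs → x ≢ y → R x y
    pairs⁻ R-sym {z ∷ zs} rs x∈ y∈ x≢y
      with rs₁ , rs₂ ← All.++⁻ (map (z ,_) zs) rs | x∈ | y∈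
    ... | here refl | here refl = contradiction refl x≢y
    ... | here refl | there y∈′ = All.lookup (All.map⁻ rs₁) y∈′
    ... | there x∈′ | here refl = R-sym (All.lookup (All.map⁻ rs₁) x∈′)
    ... | there x∈′ | there y∈′ = pairs⁻ R-sym rs₂ x∈′ y∈′ x≢y

  length-pairs : ∀ (xs : List A) → length (pairs xs) ≤ length xs ^ 2
  -- `a ^ 2` unfolds to `a * (a * 1)`; the trailing factor is removed so that the induction runs on
  -- a plain product.
  length-pairs xs = subst (length (pairs xs) ≤_) (cong (length xs *_) (sym (*-identityʳ _))) (go xs)
    where
    open ≤-Reasoning
    go : ∀ xs → length (pairs xs) ≤ length xs * length xs
    go []       = z≤n
    go (x ∷ xs) = begin
      length (map (x ,_) xs ++ pairs xs)              ≡⟨ length-++ (map (x ,_) xs) ⟩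
      length (map (x ,_) xs) + length (pairs xs)      ≡⟨ cong (_+ _) (length-map (x ,_) xs) ⟩
      length xs + length (pairs xs)                   ≤⟨ +-mono-≤ (n≤1+n _) (≤-trans (go xs) (*-monoʳ-≤ (length xs) (n≤1+n _))) ⟩
      suc (length xs) + length xs * suc (length xs)   ∎

length-cartesianProduct : ∀ {A B : Set} (xs : List A) (ys : List B) →
                          length (cartesianProduct xs ys) ≡ length xs * length ys
length-cartesianProduct []       ys = refl
length-cartesianProduct (x ∷ xs) ys = trans (length-++ (map (x ,_) ys))
  (cong₂ _+_ (length-map (x ,_) ys) (length-cartesianProduct xs ys))

square-* : ∀ a b → (a * b) ^ 2 ≡ a ^ 2 * b ^ 2
square-* a b = unfolded a b
  where
  unfolded : ∀ a b → a * b * (a * b * 1) ≡ a * (a * 1) * (b * (b * 1))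
  unfolded = ℕ.solve-∀

length-allFin : ∀ n → length (allFin n) ≡ n
length-allFin n = length-tabulate (λ (i : Fin n) → i)

-- Binary values and pointwise identities for `Δ`

binary-value : ∀ {X : Set} {z} → InDomain {X} binary z → z ≡ + χ (does (z ℤ.≟ 1ℤ))
binary-value (inj₁ refl) = refl
binary-value (inj₂ refl) = refl

χ-value : ∀ {X : Set} {z} b → z ≡ + χ b → InDomain {X} binary z × does (z ℤ.≟ 1ℤ) ≡ b
χ-value false refl = inj₁ refl , refl
χ-value true  refl = inj₂ refl , refl

Satisfies-≽ : ∀ {X : Set} (e : LinExpr X) (σ : X → ℤ) {k a} → ⟦ e ⟧ σ ≡ + a → Satisfies σ (e ≽ + k) ⇔ k ≤ a
Satisfies-≽ e σ {k} eq = mk⇔ (λ k≤e → ℤ.drop‿+≤+ (subst (+ k ℤ.≤_) eq k≤e))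
                             (λ k≤a → subst (+ k ℤ.≤_) (sym eq) (+≤+ k≤a))

disjoint : ∀ {n} {i i′ : Fin n} → i ≢ i′ → ∀ x → does (x Fin.≟ i) ∧ does (x Fin.≟ i′) ≡ false
disjoint {i = i} {i′} i≢i′ x with x Fin.≟ i
... | no _     = refl
... | yes refl = dec-false (x Fin.≟ i′) i≢i′

-- The shared coordinate, recorded by `a`, adds the same amount to both distances and cancels. What
-- remains is 1 exactly when the other coordinate of `w` matches one of the two vertices; it cannot
-- match both.
Δ-line : ∀ a c d → c ∧ d ≡ false →
         ∣ χ (not a) + χ (not c) - χ (not a) + χ (not d) ∣ ≡ χ c + χ d
Δ-line false false false _ = refl
Δ-line false false true  _ = refl
Δ-line false true  false _ = refl
Δ-line true  false false _ = refl
Δ-line true  false true  _ = refl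
Δ-line true  true  false _ = refl

-- a, b say whether w lies in the vertical layers of the two vertices, c, d whether it lies in
-- their horizontal layers.
Δ-cross : ∀ a b c d → a ∧ b ≡ false → c ∧ d ≡ false →
          ∣ χ (not a) + χ (not c) - χ (not b) + χ (not d) ∣
            + ((χ (a ∧ d) + χ (b ∧ c)) + (χ (a ∧ d) + χ (b ∧ c)))
          ≡ (χ c + χ d) + (χ a + χ b)
Δ-cross false false false false _ _ = refl
Δ-cross false false false true  _ _ = refl
Δ-cross false false true  false _ _ = refl
Δ-cross false true  false false _ _ = refl
Δ-cross false true  false true  _ _ = refl
Δ-cross false true  true  false _ _ = refl
Δ-cross true  false false false _ _ = refl
Δ-cross true  false false true  _ _ = refl
Δ-cross true  false true  false _ _ = refl

-- The hypothesis carries the corner terms with a plus sign, as an identity between natural numbers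
-- must. Subtracting them in the integers yields the left-hand side of a non-aligned constraint in
-- the form to which `⟦_⟧` unfolds.
cross-value : ∀ A B C D a b R → A ℤ.+ B ℤ.+ (C ℤ.+ D) ≡ R ℤ.+ ((a ℤ.+ b) ℤ.+ (a ℤ.+ b)) →
  1ℤ ℤ.* A ℤ.+ (1ℤ ℤ.* B ℤ.+ (1ℤ ℤ.* C ℤ.+ (1ℤ ℤ.* D
    ℤ.+ (- (+ 2) ℤ.* a ℤ.+ (- (+ 2) ℤ.* b ℤ.+ 0ℤ))))) ≡ R
cross-value A B C D a b R eq = begin
  1ℤ ℤ.* A ℤ.+ (1ℤ ℤ.* B ℤ.+ (1ℤ ℤ.* C ℤ.+ (1ℤ ℤ.* D
    ℤ.+ (- (+ 2) ℤ.* a ℤ.+ (- (+ 2) ℤ.* b ℤ.+ 0ℤ)))))          ≡⟨ regroup A B C D a b ⟩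
  A ℤ.+ B ℤ.+ (C ℤ.+ D) ℤ.- ((a ℤ.+ b) ℤ.+ (a ℤ.+ b))          ≡⟨ cong (ℤ._- _) eq ⟩
  R ℤ.+ ((a ℤ.+ b) ℤ.+ (a ℤ.+ b)) ℤ.- ((a ℤ.+ b) ℤ.+ (a ℤ.+ b)) ≡⟨ cancel R _ ⟩
  R                                                            ∎
  where
  open ≡-Reasoning
  regroup : ∀ A B C D a b → 1ℤ ℤ.* A ℤ.+ (1ℤ ℤ.* B ℤ.+ (1ℤ ℤ.* C ℤ.+ (1ℤ ℤ.* D
    ℤ.+ (- (+ 2) ℤ.* a ℤ.+ (- (+ 2) ℤ.* b ℤ.+ 0ℤ)))))
    ≡ A ℤ.+ B ℤ.+ (C ℤ.+ D) ℤ.- ((a ℤ.+ b) ℤ.+ (a ℤ.+ b))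
  regroup = solve-∀
  cancel : ∀ R e → R ℤ.+ e ℤ.- e ≡ R
  cancel = solve-∀

-- Distance as Hamming distance

module _ {n m : ℕ} where

  open Rook n m
  open ConnectedGraph K□K using (d; Δ; d-path; d-minimal; connected; unique; complete; _≟_; PathAvoiding; stop; step)

  -- The arguments of the test are swapped so that `apart i (proj₁ w)` is by definition
  -- `χ (not (vertical i w))`, and likewise for horizontal layers. This lets `Δ-line` and `Δ-cross`
  -- apply without rewriting.
  apart : ∀ {l} → Fin l → Fin l → ℕ
  apart i i′ = χ (not (does (i′ Fin.≟ i)))

  apart≤1 : ∀ {l} (i i′ : Fin l) → apart i i′ ≤ 1
  apart≤1 i i′ = χ≤1 _

  apart-refl : ∀ {l} (i : Fin l) → apart i i ≡ 0
  apart-refl i = cong (χ ∘ not) (dec-true (i Fin.≟ i) refl)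

  apart-≢ : ∀ {l} {i i′ : Fin l} → i ≢ i′ → apart i i′ ≡ 1
  apart-≢ {i = i} {i′} i≢i′ = cong (χ ∘ not) (dec-false (i′ Fin.≟ i) (i≢i′ ∘ sym))

  hamming : Vertex → Vertex → ℕ
  hamming (i , j) (i′ , j′) = apart i i′ + apart j j′

  hamming-step : ∀ {a c} b → Aligned a c → hamming a b ≤ suc (hamming c b)
  hamming-step {i , j} {_ , j″} (i′ , j′) (inj₁ (refl , _)) = begin
    apart i i′ + apart j j′         ≤⟨ +-monoʳ-≤ (apart i i′) (apart≤1 j j′) ⟩
    apart i i′ + 1                  ≡⟨ +-comm _ 1 ⟩
    suc (apart i i′)                ≤⟨ s≤s (m≤m+n _ _) ⟩
    suc (apart i i′ + apart j″ j′)  ∎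
    where open ≤-Reasoning
  hamming-step {i , j} {i″ , _} (i′ , j′) (inj₂ (_ , refl)) =
    ≤-trans (+-monoˡ-≤ (apart j j′) (apart≤1 i i′)) (s≤s (m≤n+m (apart j j′) (apart i″ i′)))

  -- Lower bound on the distance: an edge changes one coordinate, so it lowers the Hamming distance
  -- to `b` by at most 1.
  hamming-path : ∀ {xs a b ℓ} → PathAvoiding xs a b ℓ → hamming a b ≤ ℓ
  hamming-path {a = i , j} (stop _) = ≤-reflexive (cong₂ _+_ (apart-refl i) (apart-refl j))
  hamming-path {b = b} (step _ a~c p) = ≤-trans (hamming-step b a~c) (s≤s (hamming-path p))

  -- Upper bound on the distance: the path that witnesses connectedness changes each differing
  -- coordinate once, so it is already shortest.
  connected-length : ∀ a b → proj₁ (connected a b) ≡ hamming a b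
  connected-length (i , j) (i′ , j′) with i Fin.≟ i′ | j Fin.≟ j′
  ... | yes refl | yes refl = sym (cong₂ _+_ (apart-refl i) (apart-refl j))
  ... | yes refl | no j≢j′  = sym (cong₂ _+_ (apart-refl i) (apart-≢ j≢j′))
  ... | no i≢i′  | yes refl = sym (cong₂ _+_ (apart-≢ i≢i′) (apart-refl j))
  ... | no i≢i′  | no j≢j′  = sym (cong₂ _+_ (apart-≢ i≢i′) (apart-≢ j≢j′))

  d≡hamming : ∀ a b → d a b ≡ hamming a b
  d≡hamming a b = ≤-antisym
    (subst (d a b ≤_) (connected-length a b) (d-minimal a b (proj₂ (connected a b))))
    (hamming-path (d-path a b))

  Δ≡ : ∀ w x y → Δ w x y ≡ ∣ hamming x w - hamming y w ∣
  Δ≡ w x y = cong₂ ∣_-_∣ (d≡hamming x w) (d≡hamming y w)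

  -- Sums of `Δ` over a vertex set in terms of layer counts

  module _ (S : VertexSet) where

    total : (Vertex → ℕ) → ℕ
    total f = sum (map f (elements S))

    resolution : Vertex → Vertex → ℕ
    resolution x y = total (λ w → Δ w x y)

    hCount : Fin m → ℕ
    hCount j = card (S ∩ horizontal j)

    gCount : Fin n → ℕ
    gCount i = card (S ∩ vertical i)

    total-cong : ∀ {f f′} → f ≗ f′ → total f ≡ total f′
    total-cong f≗f′ = cong sum (map-cong f≗f′ (elements S))

    total-+ : ∀ f f′ → total (λ w → f w + f′ w) ≡ total f + total f′
    total-+ f f′ = sum-map-+ f f′ (elements S)

    card-∩ : ∀ L → total (χ ∘ L) ≡ card (S ∩ L)
    card-∩ L = sym (sum-χ-filterᵇ S L vertices)

    -- A vertical and a horizontal layer meet in one vertex, and `vertices` lists it once.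
    total-singleton : ∀ i j → total (λ w → χ (vertical i w ∧ horizontal j w)) ≡ χ (S (i , j))
    total-singleton i j = trans
      (total-cong (λ (i′ , j′) → cong χ (does-⇔ (mk⇔ (λ (p , q) → cong₂ _,_ p q) λ { refl → refl , refl })
        ((i′ Fin.≟ i) ×-dec (j′ Fin.≟ j)) ((i′ , j′) ≟ (i , j)))))
      (sum-filterᵇ-∈ _≟_ S (i , j) unique (complete (i , j)))

    resolution-sym : ∀ x y → resolution x y ≡ resolution y x
    resolution-sym x y = total-cong (λ w → ∣-∣-comm (d x w) (d y w))

    total-χ-pair : ∀ L L′ → total (λ w → χ (L w) + χ (L′ w)) ≡ card (S ∩ L) + card (S ∩ L′)
    total-χ-pair L L′ = trans (total-+ (χ ∘ L) (χ ∘ L′)) (cong₂ _+_ (card-∩ L) (card-∩ L′))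

    -- Two vertices of one vertical layer are told apart exactly by the horizontal layers through
    -- them, so the vertical pair yields the condition on horizontal layers.
    resolution-vertical : ∀ i {j j′} → j ≢ j′ → resolution (i , j) (i , j′) ≡ hCount j + hCount j′
    resolution-vertical i {j} {j′} j≢j′ = trans
      (total-cong λ w → trans (Δ≡ w (i , j) (i , j′))
        (Δ-line (vertical i w) (horizontal j w) (horizontal j′ w) (disjoint j≢j′ (proj₂ w))))
      (total-χ-pair (horizontal j) (horizontal j′))

    resolution-horizontal : ∀ j {i i′} → i ≢ i′ → resolution (i , j) (i′ , j) ≡ gCount i + gCount i′
    resolution-horizontal j {i} {i′} i≢i′ = trans
      (total-cong λ w → trans (Δ≡ w (i , j) (i′ , j))
        -- The summands are swapped because `Δ-line` expects the shared coordinate first.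
        (trans (cong₂ ∣_-_∣ (+-comm (apart i (proj₁ w)) _) (+-comm (apart i′ (proj₁ w)) _))
          (Δ-line (horizontal j w) (vertical i w) (vertical i′ w) (disjoint i≢i′ (proj₁ w)))))
      (total-χ-pair (vertical i) (vertical i′))

    -- The two vertices that complete `u` and `v` to a rectangle, counted when they belong to `S`.
    corners : Vertex → Vertex → ℕ
    corners (i , j) (i′ , j′) = χ (S (i , j′)) + χ (S (i′ , j))

    -- A corner of the rectangle lies in one layer of each vertex, so the layer counts see it twice;
    -- yet it has distance 1 to both and contributes nothing to the resolution. Adding each corner
    -- twice restores equality without subtraction in the natural numbers.
    resolution-cross : ∀ {i i′ j j′} → i ≢ i′ → j ≢ j′ →
      let u = i , j ; v = i′ , j′ in
      resolution u v + (corners u v + corners u v)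
      ≡ hCount j + hCount j′ + (gCount i + gCount i′)
    resolution-cross {i} {i′} {j} {j′} i≢i′ j≢j′ = begin
      resolution u v + (corners u v + corners u v)
        ≡⟨ cong (λ c → resolution u v + (c + c)) total-corner ⟨
      resolution u v + (total corner + total corner)
        ≡⟨ cong (_+_ (resolution u v)) (total-+ corner corner) ⟨
      resolution u v + total (λ w → corner w + corner w)
        ≡⟨ total-+ (λ w → Δ w u v) (λ w → corner w + corner w) ⟨
      total (λ w → Δ w u v + (corner w + corner w))
        ≡⟨ total-cong (λ w → trans (cong (_+ (corner w + corner w)) (Δ≡ w u v))
             (Δ-cross (vertical i w) (vertical i′ w) (horizontal j w) (horizontal j′ w)
               (disjoint i≢i′ (proj₁ w)) (disjoint j≢j′ (proj₂ w)))) ⟩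
      total (λ w → (χ (horizontal j w) + χ (horizontal j′ w)) + (χ (vertical i w) + χ (vertical i′ w)))
        ≡⟨ total-+ (λ w → χ (horizontal j w) + χ (horizontal j′ w)) (λ w → χ (vertical i w) + χ (vertical i′ w)) ⟩
      total (λ w → χ (horizontal j w) + χ (horizontal j′ w)) + total (λ w → χ (vertical i w) + χ (vertical i′ w))
        ≡⟨ cong₂ _+_ (total-χ-pair (horizontal j) (horizontal j′)) (total-χ-pair (vertical i) (vertical i′)) ⟩
      hCount j + hCount j′ + (gCount i + gCount i′) ∎
      where
      open ≡-Reasoning
      u v : Vertex
      u = i , j
      v = i′ , j′
      corner : Vertex → ℕ
      corner w = χ (vertical i w ∧ horizontal j′ w) + χ (vertical i′ w ∧ horizontal j w)
      total-corner : total corner ≡ corners u v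
      total-corner = trans
        (total-+ (λ w → χ (vertical i w ∧ horizontal j′ w)) (λ w → χ (vertical i′ w ∧ horizontal j w)))
        (cong₂ _+_ (total-singleton i j′) (total-singleton i′ j))

    Crossing : ℕ → Vertex → Vertex → Set
    Crossing k u@(i , j) v@(i′ , j′) = i ≢ i′ → j ≢ j′ → k ≤ resolution u v

    CrossResolving : ℕ → Set
    CrossResolving k = ∀ u v → Crossing k u v

    -- Distinct vertices share the first coordinate, the second, or neither, which gives the three
    -- families of conditions. The indices `i₀` and `j₀` supply a layer in which to place the two
    -- vertices that test a given pair of layers.
    WeakResolving-⇔ : Fin n → Fin m → ∀ k →
      WeakResolving k S ⇔ (LayerPairsContain k S × CrossResolving k)
    WeakResolving-⇔ i₀ j₀ k = mk⇔
      (λ wr → ((λ i i′ i≢i′ → subst (k ≤_) (resolution-horizontal j₀ i≢i′)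
                  (wr (i , j₀) (i′ , j₀) (i≢i′ ∘ cong proj₁)))
              , (λ j j′ j≢j′ → subst (k ≤_) (resolution-vertical i₀ j≢j′)
                  (wr (i₀ , j) (i₀ , j′) (j≢j′ ∘ cong proj₂))))
            , (λ u v i≢i′ _ → wr u v (i≢i′ ∘ cong proj₁)))
      (uncurry resolving)
      where
      resolving : LayerPairsContain k S → CrossResolving k → WeakResolving k S
      resolving (gs , hs) cr x@(i , j) y@(i′ , j′) x≢y with i Fin.≟ i′ | j Fin.≟ j′
      ... | yes refl | yes refl = contradiction refl x≢y
      ... | yes refl | no j≢j′  = subst (k ≤_) (sym (resolution-vertical i j≢j′)) (hs j j′ j≢j′)
      ... | no i≢i′  | yes refl = subst (k ≤_) (sym (resolution-horizontal j i≢i′)) (gs i i′ i≢i′)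
      ... | no i≢i′  | no j≢j′  = cr x y i≢i′ j≢j′

    -- The two layer pairs contribute at least 2k, and the corners subtract at most 4 ≤ k.
    layers⇒cross : ∀ {k} → 4 ≤ k → LayerPairsContain k S → CrossResolving k
    layers⇒cross {k} 4≤k (gs , hs) u@(i , j) v@(i′ , j′) i≢i′ j≢j′ =
      +-cancelʳ-≤ 4 k (resolution u v) (begin
        k + 4                                          ≤⟨ +-monoʳ-≤ k 4≤k ⟩
        k + k                                          ≤⟨ +-mono-≤ (hs j j′ j≢j′) (gs i i′ i≢i′) ⟩
        hCount j + hCount j′ + (gCount i + gCount i′)  ≡⟨ resolution-cross i≢i′ j≢j′ ⟨
        resolution u v + (corners u v + corners u v)   ≤⟨ +-monoʳ-≤ (resolution u v) (+-mono-≤ corners≤2 corners≤2) ⟩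
        resolution u v + 4                             ∎)
      where
      open ≤-Reasoning
      corners≤2 : corners u v ≤ 2
      corners≤2 = +-mono-≤ (χ≤1 (S (i , j′))) (χ≤1 (S (i′ , j)))

  -- Integer points that represent vertex sets

  record Represents (σ : Var → ℤ) (S : VertexSet) : Set where
    field
      s-value : ∀ u → σ (s u) ≡ + χ (S u)
      h-value : ∀ j → σ (h j) ≡ + hCount S j
      g-value : ∀ i → σ (g i) ≡ + gCount S i

  open Represents

  encode : VertexSet → Var → ℤ
  encode S (s u) = + χ (S u)
  encode S (h j) = + hCount S j
  encode S (g i) = + gCount S i

  encode-represents : ∀ S → Represents (encode S) S
  encode-represents S = record
    { s-value = λ _ → refl ; h-value = λ _ → refl ; g-value = λ _ → refl }

  module _ {σ : Var → ℤ} {S : VertexSet} (s-values : ∀ u → σ (s u) ≡ + χ (S u)) where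

    -- Only the `s`-values are assumed, because `represents` uses this evaluation to derive the
    -- values of the `h`- and `g`-variables.
    ⟦sumS⟧ : ∀ us → ⟦ sumS us ⟧ σ ≡ + length (filterᵇ S us)
    ⟦sumS⟧ []       = refl
    ⟦sumS⟧ (u ∷ us) rewrite s-values u | ⟦sumS⟧ us with S u
    ... | false = refl
    ... | true  = refl

    ⟦sumS⟧-elements : ∀ L → ⟦ sumS (elements L) ⟧ σ ≡ + card (S ∩ L)
    ⟦sumS⟧-elements L = trans (⟦sumS⟧ (elements L)) (cong +_ (sym (length-filterᵇ-∧ S L vertices)))

  ⟦variable⟧ : ∀ (σ : Var → ℤ) x → ⟦ (1ℤ , x) ∷ [] ⟧ σ ≡ σ x
  ⟦variable⟧ σ x = lemma (σ x)
    where
    lemma : ∀ z → 1ℤ ℤ.* z ℤ.+ 0ℤ ≡ z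
    lemma = solve-∀

  ⟦pair⟧ : ∀ (σ : Var → ℤ) x y {a b} → σ x ≡ + a → σ y ≡ + b →
           ⟦ (1ℤ , x) ∷ (1ℤ , y) ∷ [] ⟧ σ ≡ + (a + b)
  ⟦pair⟧ σ x y {a} {b} p q = trans (lemma (σ x) (σ y)) (cong₂ ℤ._+_ p q)
    where
    lemma : ∀ z w → 1ℤ ℤ.* z ℤ.+ (1ℤ ℤ.* w ℤ.+ 0ℤ) ≡ z ℤ.+ w
    lemma = solve-∀

  module _ {σ : Var → ℤ} {S : VertexSet} (rep : Represents σ S) where

    private
      ⟦hDef⟧ : ∀ j → Satisfies σ (((1ℤ , h j) ∷ []) ≐ sumS (elements (horizontal j)))
      ⟦hDef⟧ j = trans (⟦variable⟧ σ (h j))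
        (trans (h-value rep j) (sym (⟦sumS⟧-elements (s-value rep) (horizontal j))))

      ⟦gDef⟧ : ∀ i → Satisfies σ (((1ℤ , g i) ∷ []) ≐ sumS (elements (vertical i)))
      ⟦gDef⟧ i = trans (⟦variable⟧ σ (g i))
        (trans (g-value rep i) (sym (⟦sumS⟧-elements (s-value rep) (vertical i))))

    hDefs-sat : All (Satisfies σ) hDefs
    hDefs-sat = All.map⁺ (All.tabulate (λ {j} _ → ⟦hDef⟧ j))

    gDefs-sat : All (Satisfies σ) gDefs
    gDefs-sat = All.map⁺ (All.tabulate (λ {i} _ → ⟦gDef⟧ i))

    hPairs-⇔ : ∀ k → All (Satisfies σ) (hPairs k) ⇔ (∀ j j′ → j ≢ j′ → k ≤ hCount S j + hCount S j′)
    hPairs-⇔ k = mk⇔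
      (λ sat j j′ → pairs⁻ {R = λ j j′ → k ≤ hCount S j + hCount S j′}
        (λ {j} {j′} → subst (k ≤_) (+-comm (hCount S j) (hCount S j′)))
        (All.map (λ {p} → to (equiv p)) (All.map⁻ sat)) (∈-allFin j) (∈-allFin j′))
      (λ hs → All.map⁺ (All.map (λ {p} → from (equiv p)) (pairs⁺ (allFin⁺ m) hs)))
      where
      equiv : ∀ ((j , j′) : Fin m × Fin m) →
        Satisfies σ (((1ℤ , h j) ∷ (1ℤ , h j′) ∷ []) ≽ + k) ⇔ k ≤ hCount S j + hCount S j′
      equiv (j , j′) = Satisfies-≽ ((1ℤ , h j) ∷ (1ℤ , h j′) ∷ []) σ
        (⟦pair⟧ σ (h j) (h j′) (h-value rep j) (h-value rep j′))

    gPairs-⇔ : ∀ k → All (Satisfies σ) (gPairs k) ⇔ (∀ i i′ → i ≢ i′ → k ≤ gCount S i + gCount S i′)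
    gPairs-⇔ k = mk⇔
      (λ sat i i′ → pairs⁻ {R = λ i i′ → k ≤ gCount S i + gCount S i′}
        (λ {i} {i′} → subst (k ≤_) (+-comm (gCount S i) (gCount S i′)))
        (All.map (λ {p} → to (equiv p)) (All.map⁻ sat)) (∈-allFin i) (∈-allFin i′))
      (λ gs → All.map⁺ (All.map (λ {p} → from (equiv p)) (pairs⁺ (allFin⁺ n) gs)))
      where
      equiv : ∀ ((i , i′) : Fin n × Fin n) →
        Satisfies σ (((1ℤ , g i) ∷ (1ℤ , g i′) ∷ []) ≽ + k) ⇔ k ≤ gCount S i + gCount S i′
      equiv (i , i′) = Satisfies-≽ ((1ℤ , g i) ∷ (1ℤ , g i′) ∷ []) σ
        (⟦pair⟧ σ (g i) (g i′) (g-value rep i) (g-value rep i′))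

    nonAligned-⇔ : ∀ k {i i′ j j′} → i ≢ i′ → j ≢ j′ → let u = i , j ; v = i′ , j′ in
      Satisfies σ (nonAligned k (u , v)) ⇔ k ≤ resolution S u v
    nonAligned-⇔ k {i} {i′} {j} {j′} i≢i′ j≢j′ = Satisfies-≽ e σ
      (cross-value (σ (h j)) (σ (h j′)) (σ (g i)) (σ (g i′)) (σ (s (i , j′))) (σ (s (i′ , j))) _ eq)
      where
      e : LinExpr Var
      e = (1ℤ , h j) ∷ (1ℤ , h j′) ∷ (1ℤ , g i) ∷ (1ℤ , g i′)
        ∷ (- (+ 2) , s (i , j′)) ∷ (- (+ 2) , s (i′ , j)) ∷ []
      eq : σ (h j) ℤ.+ σ (h j′) ℤ.+ (σ (g i) ℤ.+ σ (g i′))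
         ≡ + resolution S (i , j) (i′ , j′) ℤ.+ ((σ (s (i , j′)) ℤ.+ σ (s (i′ , j))) ℤ.+ (σ (s (i , j′)) ℤ.+ σ (s (i′ , j))))
      eq rewrite h-value rep j | h-value rep j′ | g-value rep i | g-value rep i′
               | s-value rep (i , j′) | s-value rep (i′ , j) = cong +_ (sym (resolution-cross S i≢i′ j≢j′))

    nonAlignedPairs-⇔ : ∀ k → All (Satisfies σ) (nonAlignedPairs k) ⇔ CrossResolving S k
    nonAlignedPairs-⇔ k = mk⇔
      (λ sat u v i≢i′ → pairs⁻ {R = Crossing S k} (λ {u} {v} → crossing-sym u v)
        (All.map (λ f i≢i′ j≢j′ → to (nonAligned-⇔ k i≢i′ j≢j′) (f (crossing⇒¬aligned i≢i′ j≢j′)))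
          (All-filter⁻ nonAligned? (All.map⁻ sat)))
        (complete u) (complete v) (i≢i′ ∘ cong proj₁) i≢i′)
      (λ cr → All.map⁺ (All-filter⁺ nonAligned? (pairs⁺ unique λ u v u≢v ¬al →
        -- Distinct vertices that agreed in one coordinate would differ in the other and be aligned;
        -- hence both coordinates differ.
        let i≢i′ = λ i≡i′ → ¬al (inj₁ (i≡i′ , λ j≡j′ → u≢v (cong₂ _,_ i≡i′ j≡j′)))
            j≢j′ = λ j≡j′ → ¬al (inj₂ ((λ i≡i′ → u≢v (cong₂ _,_ i≡i′ j≡j′)) , j≡j′))
        in from (nonAligned-⇔ k i≢i′ j≢j′) (cr u v i≢i′ j≢j′))))
      where
      nonAligned? : Decidable (λ ((u , v) : Vertex × Vertex) → ¬ Aligned u v)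
      nonAligned? (u , v) = ¬? (aligned? u v)
      crossing⇒¬aligned : ∀ {i i′ j j′} → i ≢ i′ → j ≢ j′ → ¬ Aligned (i , j) (i′ , j′)
      crossing⇒¬aligned i≢i′ j≢j′ = [ i≢i′ ∘ proj₁ , j≢j′ ∘ proj₂ ]′
      crossing-sym : ∀ u v → Crossing S k u v → Crossing S k v u
      crossing-sym u v cr i≢i′ j≢j′ =
        subst (k ≤_) (resolution-sym S u v) (cr (i≢i′ ∘ sym) (j≢j′ ∘ sym))

    support≗ : support σ ≗ S
    support≗ u = proj₂ (χ-value {Var} (S u) (s-value rep u))

    in-domain : ∀ x → InDomain {Var} (domain x) (σ x)
    in-domain (s u) = proj₁ (χ-value {Var} (S u) (s-value rep u))
    in-domain (h _) = tt
    in-domain (g _) = tt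

    layers-⇔ : ∀ k → Feasible (F-without-nonAligned k) σ ⇔ LayerPairsContain k S
    layers-⇔ k = mk⇔
      (λ (sat , _) → let (hs , gs) = All.++⁻ (hPairs k) (All.++⁻ʳ gDefs (All.++⁻ʳ hDefs sat))
                     in to (gPairs-⇔ k) gs , to (hPairs-⇔ k) hs)
      (λ (gs , hs) → All.++⁺ hDefs-sat (All.++⁺ gDefs-sat
          (All.++⁺ (from (hPairs-⇔ k) hs) (from (gPairs-⇔ k) gs))) , in-domain)

  -- Feasible points and conditions on layers

  Feasible-split : ∀ k σ → Feasible (F k) σ
    ⇔ (Feasible (F-without-nonAligned k) σ × All (Satisfies σ) (nonAlignedPairs k))
  Feasible-split k σ = mk⇔
    (λ (sat , dom) →
      let (hd , sat₁) = All.++⁻ hDefs sat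
          (gd , sat₂) = All.++⁻ gDefs sat₁
          (hp , sat₃) = All.++⁻ (hPairs k) sat₂
          (gp , na)   = All.++⁻ (gPairs k) sat₃
      in (All.++⁺ hd (All.++⁺ gd (All.++⁺ hp gp)) , dom) , na)
    (λ ((sat , dom) , na) →
      let (hd , sat₁) = All.++⁻ hDefs sat
          (gd , sat₂) = All.++⁻ gDefs sat₁
          (hp , gp)   = All.++⁻ (hPairs k) sat₂
      in All.++⁺ hd (All.++⁺ gd (All.++⁺ hp (All.++⁺ gp na))) , dom)

  -- The defining equalities leave no freedom in `h` and `g`, so a feasible point is determined by
  -- its support. They already belong to the program without the non-aligned constraints, so the
  -- result serves both programs.
  represents : ∀ {k σ S} → Feasible (F-without-nonAligned k) σ → support σ ≗ S → Represents σ S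
  represents {k} {σ} {S} (sat , dom) supp = record
    { s-value = s-values
    ; h-value = λ j → trans (sym (⟦variable⟧ σ (h j)))
        (trans (All.lookup (All.map⁻ (proj₁ defs)) (∈-allFin j)) (⟦sumS⟧-elements s-values (horizontal j)))
    ; g-value = λ i → trans (sym (⟦variable⟧ σ (g i)))
        (trans (All.lookup (All.map⁻ (All.++⁻ˡ gDefs (proj₂ defs))) (∈-allFin i)) (⟦sumS⟧-elements s-values (vertical i)))
    }
    where
    s-values : ∀ u → σ (s u) ≡ + χ (S u)
    s-values u = trans (binary-value {Var} (dom (s u))) (cong (+_ ∘ χ) (supp u))
    defs : All (Satisfies σ) hDefs × All (Satisfies σ) (gDefs ++ hPairs k ++ gPairs k)
    defs = All.++⁻ hDefs sat

  Feasible-⇔ : ∀ {σ S} → Represents σ S → ∀ k → Feasible (F k) σ ⇔ (LayerPairsContain k S × CrossResolving S k)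
  Feasible-⇔ {σ} rep k = mk⇔
    (λ feas → let (feas′ , na) = to (Feasible-split k σ) feas
              in to (layers-⇔ rep k) feas′ , to (nonAlignedPairs-⇔ rep k) na)
    (λ (lp , cr) → from (Feasible-split k σ) (from (layers-⇔ rep k) lp , from (nonAlignedPairs-⇔ rep k) cr))

  Feasible⇒Represents : ∀ {k σ S} → Feasible (F k) σ → support σ ≗ S → Represents σ S
  Feasible⇒Represents {k} {σ} feas = represents {k} (proj₁ (to (Feasible-split k σ) feas))

  -- Read on the support of `σ`, this is `layers⇒cross`.
  nonAligned-redundant : ∀ {k} → 4 ≤ k → ∀ σ → Feasible (F-without-nonAligned k) σ ⇔ Feasible (F k) σ
  nonAligned-redundant {k} 4≤k σ = mk⇔
    (λ feas → let rep = represents {k} feas (λ _ → refl)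
                  lp  = to (layers-⇔ rep k) feas
              in from (Feasible-⇔ rep k) (lp , layers⇒cross (support σ) 4≤k lp))
    (λ feas → proj₁ (to (Feasible-split k σ) feas))

  feasible-supports : ∀ {k} → 4 ≤ k → ∀ S → (∃[ σ ] Feasible (F k) σ × support σ ≗ S) ⇔ LayerPairsContain k S
  feasible-supports {k} 4≤k S = mk⇔
    (λ (σ , feas , supp) → proj₁ (to (Feasible-⇔ (Feasible⇒Represents {k} feas supp) k) feas))
    (λ lp → let rep = encode-represents S in
      encode S , from (Feasible-⇔ rep k) (lp , layers⇒cross S 4≤k lp) , support≗ rep)

  -- Existence of a weak `k`-metric basis

  WeakResolving-resp : ∀ {k S T} → S ≗ T → WeakResolving k S → WeakResolving k T
  WeakResolving-resp {k} S≗T wr x y x≢y =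
    subst (λ us → k ≤ sum (map (λ w → Δ w x y) us)) (filterᵇ-cong S≗T vertices) (wr x y x≢y)

  weakResolving? : ∀ k → Decidable (WeakResolving k)
  weakResolving? k S = map′ (λ f (i , j) (i′ , j′) → f i j i′ j′) (λ f i j i′ j′ → f (i , j) (i′ , j′))
    (all? λ i → all? λ j → all? λ i′ → all? λ j′ →
      ¬? ((i , j) ≟ (i′ , j′)) →-dec (k ≤? resolution S (i , j) (i′ , j′)))

  -- Vertex sets are functions to `Bool`; coding them as bit vectors of length `n * m` makes an
  -- exhaustive search possible.
  fromSubset : Subset (n * m) → VertexSet
  fromSubset p (i , j) = lookup p (combine i j)

  toSubset : VertexSet → Subset (n * m)
  toSubset S = tabulate (λ x → S (remQuot {n} m x))

  fromSubset-toSubset : ∀ S → fromSubset (toSubset S) ≗ S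
  fromSubset-toSubset S (i , j) =
    trans (lookup∘tabulate (λ x → S (remQuot {n} m x)) (combine i j)) (cong S (remQuot-combine i j))

  -- The cardinalities of weak `k`-resolving sets form a decidable nonempty set of natural numbers,
  -- and its least element is attained by a basis.
  weakBasis : ∀ {k} → ∃[ S ] WeakResolving k S → ∃[ S ] WeakBasis k S
  weakBasis {k} (S , wr) =
    let (ℓ , (p , wrₚ , eq) , ℓ≤) = least attained? (card S) (attained S wr)
    in fromSubset p , wrₚ , λ T wrT → subst (_≤ card T) (sym eq) (ℓ≤ (attained T wrT))
    where
    Attained : ℕ → Set
    Attained c = ∃[ p ] WeakResolving k (fromSubset p) × card (fromSubset p) ≡ c
    attained? : Decidable Attained
    attained? c = anySubset? λ p →
      weakResolving? k (fromSubset p) ×-dec (card (fromSubset p) ℕ.≟ c)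
    attained : ∀ T → WeakResolving k T → Attained (card T)
    attained T wrT = toSubset T , WeakResolving-resp {k} (sym ∘ fromSubset-toSubset T) wrT
      , cong length (filterᵇ-cong (fromSubset-toSubset T) vertices)

  -- Optimal solutions and weak `k`-metric bases

  module _ (i₀ : Fin n) (j₀ : Fin m) (k : ℕ) where

    Feasible⇔WeakResolving : ∀ {σ S} → Represents σ S → Feasible (F k) σ ⇔ WeakResolving k S
    Feasible⇔WeakResolving {S = S} rep = mk⇔
      (from (WeakResolving-⇔ S i₀ j₀ k) ∘ to (Feasible-⇔ rep k))
      (from (Feasible-⇔ rep k) ∘ to (WeakResolving-⇔ S i₀ j₀ k))

    objective≡card : ∀ {σ S} → Represents σ S → ⟦ sumS vertices ⟧ σ ≡ + card S
    objective≡card rep = ⟦sumS⟧ (s-value rep) vertices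

    -- Competitors correspond in both directions: a set `T` gives the point `encode T`, a feasible
    -- `τ` gives the set `support τ`, and the objective equals the cardinality each time.
    Optimal⇔WeakBasis : ∀ {σ S} → Represents σ S → Optimal (F k) σ ⇔ WeakBasis k S
    Optimal⇔WeakBasis {σ} {S} rep = mk⇔
      (λ (feas , opt) → to (Feasible⇔WeakResolving rep) feas , λ T wrT →
        let repT = encode-represents T in
        ℤ.drop‿+≤+ (subst₂ ℤ._≤_ (objective≡card rep) (objective≡card repT)
          (opt (encode T) (from (Feasible⇔WeakResolving repT) wrT))))
      (λ (wr , min) → from (Feasible⇔WeakResolving rep) wr , λ τ feasτ →
        let repτ = Feasible⇒Represents {k} feasτ (λ _ → refl) in
        subst₂ ℤ._≤_ (sym (objective≡card rep)) (sym (objective≡card repτ))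
          (+≤+ (min (support τ) (to (Feasible⇔WeakResolving repτ) feasτ))))

    optimal : ∃[ S ] WeakResolving k S → ∃[ σ ] Optimal (F k) σ
    optimal wr = let (S , basis) = weakBasis {k} wr in
      encode S , from (Optimal⇔WeakBasis (encode-represents S)) basis

    optimal⇒basis : ∀ σ → Optimal (F k) σ → WeakBasis k (support σ)
    optimal⇒basis σ opt@(feas , _) = to (Optimal⇔WeakBasis (Feasible⇒Represents {k} feas (λ _ → refl))) opt

  -- Numbers of constraints

  length-hPairs : ∀ k → length (hPairs k) ≤ m ^ 2
  length-hPairs k = begin
    length (hPairs k)         ≡⟨ length-map _ (pairs (allFin m)) ⟩
    length (pairs (allFin m)) ≤⟨ length-pairs (allFin m) ⟩
    length (allFin m) ^ 2     ≡⟨ cong (_^ 2) (length-allFin m) ⟩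
    m ^ 2                     ∎
    where open ≤-Reasoning

  length-gPairs : ∀ k → length (gPairs k) ≤ n ^ 2
  length-gPairs k = begin
    length (gPairs k)         ≡⟨ length-map _ (pairs (allFin n)) ⟩
    length (pairs (allFin n)) ≤⟨ length-pairs (allFin n) ⟩
    length (allFin n) ^ 2     ≡⟨ cong (_^ 2) (length-allFin n) ⟩
    n ^ 2                     ∎
    where open ≤-Reasoning

  length-nonAlignedPairs : ∀ k → length (nonAlignedPairs k) ≤ n ^ 2 * m ^ 2
  length-nonAlignedPairs k = begin
    length (nonAlignedPairs k)                 ≡⟨ length-map (nonAligned k) (filter nonAligned? (pairs vertices)) ⟩
    length (filter nonAligned? (pairs vertices)) ≤⟨ length-filter nonAligned? (pairs vertices) ⟩
    length (pairs vertices)                    ≤⟨ length-pairs vertices ⟩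
    length vertices ^ 2                        ≡⟨ cong (_^ 2) (length-cartesianProduct (allFin n) (allFin m)) ⟩
    (length (allFin n) * length (allFin m)) ^ 2 ≡⟨ cong₂ (λ a b → (a * b) ^ 2) (length-allFin n) (length-allFin m) ⟩
    (n * m) ^ 2                                ≡⟨ square-* n m ⟩
    n ^ 2 * m ^ 2                              ∎
    where
    open ≤-Reasoning
    nonAligned? : Decidable (λ ((u , v) : Vertex × Vertex) → ¬ Aligned u v)
    nonAligned? (u , v) = ¬? (aligned? u v)

corollary4p3 : (∀ n m k → Admissible n m k → let open Rook n m in
    ((∃[ σ ] Optimal (F k) σ) × (∀ σ → Optimal (F k) σ → WeakBasis k (support σ)))
    × (length hDefs ≡ m × length gDefs ≡ n)
    × (4 ≤ k → ∀ σ → Feasible (F-without-nonAligned k) σ ⇔ Feasible (F k) σ)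
    × (4 ≤ k → ∀ S → (∃[ σ ] Feasible (F k) σ × support σ ≗ S) ⇔ LayerPairsContain k S))
    × BigO (λ n m k → length (Rook.hPairs n m k)) (λ n m k → m ^ 2)
    × BigO (λ n m k → length (Rook.gPairs n m k)) (λ n m k → n ^ 2)
    × BigO (λ n m k → length (Rook.nonAlignedPairs n m k)) (λ n m k → n ^ 2 * m ^ 2)
corollary4p3 =
    (λ n m k (2≤n , 2≤m , _ , κ , ((S , wr) , _) , k≤κ) →
      let i₀ = fromℕ< (≤-trans (n≤1+n 1) 2≤n)
          j₀ = fromℕ< (≤-trans (n≤1+n 1) 2≤m)
      -- The set `S` attaining `κ` is weak `κ`-resolving, hence weak `k`-resolving since `k ≤ κ`; so
      -- the program is feasible.
      in (optimal i₀ j₀ k (S , λ x y x≢y → ≤-trans k≤κ (wr x y x≢y)) , optimal⇒basis i₀ j₀ k)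
       , (trans (length-map _ (allFin m)) (length-allFin m) , trans (length-map _ (allFin n)) (length-allFin n))
       , nonAligned-redundant
       , feasible-supports)
  -- The bounds hold with constant 1, and `1 * b` unfolds to `b + 0`.
  , (1 , λ n m k _ → ≤-trans (length-hPairs {n} {m} k) (m≤m+n _ 0))
  , (1 , λ n m k _ → ≤-trans (length-gPairs {n} {m} k) (m≤m+n _ 0))
  , (1 , λ n m k _ → ≤-trans (length-nonAlignedPairs {n} {m} k) (m≤m+n _ 0))
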